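{- Let $K$ be a $2$-dimensional simplicial complex that is an obstruction to shellability. Then $K$ has at most $7$ vertices. In other words, there are no $2$-dimensional obstructions to shellability with more than $7$ vertices.
   Context: All simplicial complexes are finite (abstract) and contain the empty face; if $K$ is a simplicial complex on vertex set $V$, then $\{v\}\in K$ for every $v\in V$. Facets are the inclusion-maximal faces; $\dim F=|F|-1$. A complex is pure if all its facets have the same dimension. For $U\subseteq V$, the induced subcomplex $K(U)$ is $\{F\in K: F\subseteq U\}$; it is proper if $U\subsetneq V$. Shellability means (not necessarily pure) shellability: $K$ is shellable if its facets can be ordered $F_1,\dots,F_t$ so that for each $k=2,\dots,t$ the complex $\left(\bigcup_{i=1}^{k-1}\bar F_i\right)\cap \bar F_k$ is pure of dimension $\dim F_k-1$, where $\bar F$ denotes the simplex consisting of all subsets of $F$. An obstruction to shellability is a nonshellable simplicial complex all of whose proper induced subcomplexes are shellable. -}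

module Defs where

open import Data.Fin.Base as Fin using (Fin; toℕ)
open import Data.Fin.Subset using (Subset; _∈_; _⊆_; _⊂_; ⁅_⁆; ⊥; ∣_∣)
open import Data.Fin.Subset.Properties using (_⊆?_; ⊥⊆; ⊆-trans; x∈⁅y⁆⇒x≡y)
open import Data.Integer.Base as ℤ using (ℤ; +_; 1ℤ)
open import Data.List.Base using (List; length; lookup)
import Data.List.Membership.Propositional as List
open import Data.List.Relation.Unary.Unique.Propositional using (Unique)
open import Data.Nat.Base as ℕ using (ℕ)
open import Data.Product.Base using (∃-syntax; _×_; _,_; proj₁)
open import Function.Bundles using (_⇔_)
open import Level using (0ℓ)
open import Relation.Binary.PropositionalEquality using (_≡_; refl)
open import Relation.Nullary.Decidable using (_×-dec_)
open import Relation.Nullary.Negation using (¬_)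
open import Relation.Unary using (Pred; Decidable; _∩_)

-- The vertex set is a subset of Fin n rather than all of Fin n, so that an
-- induced subcomplex K(U) is again a complex, with vertex set U.

record SimplicialComplex (n : ℕ) : Set₁ where
  field
    vertices    : Subset n
    Face        : Pred (Subset n) 0ℓ
    face?       : Decidable Face
    face⊆       : ∀ {F} → Face F → F ⊆ vertices
    empty-face  : Face ⊥
    vertex-face : ∀ {v} → v ∈ vertices → Face ⁅ v ⁆
    down-closed : ∀ {F G} → G ⊆ F → Face F → Face G

open SimplicialComplex public

private
  variable
    n : ℕ

induced : (K : SimplicialComplex n) (U : Subset n) → U ⊆ vertices K →
          SimplicialComplex n
induced K U U⊆V = record
  { vertices    = U
  ; Face        = λ F → Face K F × F ⊆ U
  ; face?       = λ F → face? K F ×-dec (F ⊆? U)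
  ; face⊆       = λ (_ , F⊆U) → F⊆U
  ; empty-face  = empty-face K , ⊥⊆
  ; vertex-face = λ v∈U → vertex-face K (U⊆V v∈U) , ⁅⁆⊆ v∈U
  ; down-closed = λ G⊆F (KF , F⊆U) → down-closed K G⊆F KF , ⊆-trans G⊆F F⊆U
  }
  where
  ⁅⁆⊆ : ∀ {v} → v ∈ U → ⁅ v ⁆ ⊆ U
  ⁅⁆⊆ v∈U x∈⁅v⁆ with refl ← x∈⁅y⁆⇒x≡y _ x∈⁅v⁆ = v∈U

-- Integer-valued, so that dim ⊥ is -1.

dim : Subset n → ℤ
dim F = + ∣ F ∣ ℤ.- 1ℤ

-- Facets, dimension and purity depend only on the collection of faces, so
-- they are stated for an arbitrary family of subsets.

IsFacet : Pred (Subset n) 0ℓ → Pred (Subset n) 0ℓ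
IsFacet P F = P F × (∀ G → P G → F ⊆ G → F ≡ G)

HasDimension : Pred (Subset n) 0ℓ → ℤ → Set
HasDimension P d = (∃[ F ] P F × dim F ≡ d) × (∀ F → P F → dim F ℤ.≤ d)

IsPure : Pred (Subset n) 0ℓ → Set
IsPure P = ∀ F G → IsFacet P F → IsFacet P G → dim F ≡ dim G

simplex : Subset n → Pred (Subset n) 0ℓ
simplex F G = G ⊆ F

earlier : (Fs : List (Subset n)) → Fin (length Fs) → Pred (Subset n) 0ℓ
earlier Fs k G = ∃[ i ] i Fin.< k × simplex (lookup Fs i) G

-- Indices start at 0, so the first facet is the one exempted by 0 < toℕ k.

record IsShelling (K : SimplicialComplex n) (Fs : List (Subset n)) : Set where
  field
    unique : Unique Fs
    facets : ∀ F → F List.∈ Fs ⇔ IsFacet (Face K) F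
    attach : ∀ k → 0 ℕ.< toℕ k →
             let I = earlier Fs k ∩ simplex (lookup Fs k) in
             IsPure I × HasDimension I (dim (lookup Fs k) ℤ.- 1ℤ)

Shellable : SimplicialComplex n → Set
Shellable K = ∃[ Fs ] IsShelling K Fs

IsObstruction : SimplicialComplex n → Set
IsObstruction K =
  ¬ Shellable K ×
  (∀ U (U⊂V : U ⊂ vertices K) → Shellable (induced K U (proj₁ U⊂V)))

{-# OPTIONS --safe #-}

-- Let K be 2-dimensional on at least 8 vertices, all proper induced subcomplexes
-- being shellable.  Two triangles span at most 6 vertices, so the induced complex
-- on their union is shellable; hence it is strongly connected, and so is the link
-- of every face common to both triangles.  Let t₁ ∋ x and t₀ ∌ x be triangles
-- sharing an edge.  Start with a shelling of the triangles of K - x, append t₁, and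
-- keep attaching triangles through x.  Suppose that no remaining triangle can be
-- attached.  Let W be the set of vertices joined to x so far.  Then
-- φ(u,v) = [u ∈ W] + [v ∈ W], set to 0 on the edges of triangles avoiding x, is a
-- mod 2 cocycle, and connectivity of links gives a triangle t ∋ x with an edge that
-- lies outside W and is shared with a triangle t′ ∌ x.  A walk from x into t₀,
-- inside t₀ ∪ t′ to t′, and back to x has odd φ-sum.  But t₀ ∪ t′ ∪ {x} has at most
-- 7 vertices, so it induces a shellable complex, on whose triangles every cocycle is
-- a coboundary: a contradiction.  The edge facets and isolated vertices of K can be
-- added last.

module Submission where

open import Data.Bool.Base using (Bool; true; false; not; _xor_)
import Data.Bool.Properties as Bool
open import Data.Bool.Properties using (xor-assoc; xor-comm; xor-same; xor-identityʳ)
open import Data.Fin.Base as Fin using (Fin; zero; suc; toℕ)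
import Data.Fin.Properties as Fin
open import Data.Fin.Subset
open import Data.Fin.Subset.Properties
open import Data.Integer.Base as ℤ using (+_; 1ℤ)
import Data.Integer.Properties as ℤ
open import Data.List.Base
  using (List; []; _∷_; _++_; _ʳ++_; filter; length; lookup; map; reverse)
import Data.List.Membership.DecPropositional as DecMembership
import Data.List.Membership.Propositional as List
import Data.List.Membership.Propositional.Properties as List
open import Data.List.Properties using (reverse-involutive; filter-accept; filter-reject)
open import Data.List.Relation.Binary.Permutation.Propositional using (↭-sym; ↭⇒↭ₛ)
open import Data.List.Relation.Binary.Permutation.Propositional.Properties using (↭-reverse)
import Data.List.Relation.Binary.Permutation.Setoid.Properties as Permutation
open import Data.List.Relation.Unary.All as All using ()
open import Data.List.Relation.Unary.AllPairs using ([]; _∷_)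
open import Data.List.Relation.Unary.Any as Any using (Any; here; there; any?)
import Data.List.Relation.Unary.Any.Properties as Any
open import Data.List.Relation.Unary.Unique.Propositional using (Unique)
open import Data.Nat.Base as ℕ using (ℕ; suc; _≤_; _<_; z≤n; s≤s; z<s; s<s; _+_)
import Data.Nat.Properties as ℕ
open import Data.Product.Base using (∃-syntax; _×_; _,_; proj₁; proj₂)
open import Data.Sum.Base using (_⊎_; inj₁; inj₂)
open import Data.Vec.Base using ([]; _∷_; here; there)
import Data.Vec.Properties as Vec
open import Function.Base using (_∘_; id)
open import Function.Bundles using (Equivalence; mk⇔)
open import Level using (0ℓ)
open import Relation.Binary.PropositionalEquality
  using (_≡_; _≢_; refl; sym; trans; cong; cong₂; subst; setoid)
open import Relation.Nullary.Decidable
  using (Dec; yes; no; _×-dec_; ¬?; decidable-stable; does; does-⇔; dec-true; dec-false)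
open import Relation.Nullary.Negation using (¬_; contradiction)
open import Relation.Unary using (Pred; Decidable)
open import Defs

private
  variable
    n : ℕ
    p q F G H : Subset n
    u v w x y z : Fin n
    D : List (Subset n)
    m : ℕ

-- Cardinalities of finite subsets.

x∉p-x : ∀ (p : Subset n) x → x ∉ p - x
x∉p-x (_ ∷ _) zero    ()
x∉p-x (_ ∷ p) (suc x) (there h) = x∉p-x p x h

y∈p-x⇒y≢x : y ∈ p - x → y ≢ x
y∈p-x⇒y≢x {p = p} {x = x} y∈ refl = x∉p-x p x y∈

p-x⊆p : ∀ (p : Subset n) x → p - x ⊆ p
p-x⊆p p x = p─q⊆p p ⁅ x ⁆

⊆-remove : p ⊆ q → x ∉ p → p ⊆ q - x
⊆-remove p⊆q x∉p y∈p = x∈p∧x≢y⇒x∈p-y (p⊆q y∈p) λ { refl → x∉p y∈p }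

∣p∪q∣≤∣p∣+∣q∣ : ∀ (p q : Subset n) → ∣ p ∪ q ∣ ≤ ∣ p ∣ + ∣ q ∣
∣p∪q∣≤∣p∣+∣q∣ []            []            = z≤n
∣p∪q∣≤∣p∣+∣q∣ (outside ∷ p) (outside ∷ q) = ∣p∪q∣≤∣p∣+∣q∣ p q
∣p∪q∣≤∣p∣+∣q∣ (outside ∷ p) (inside  ∷ q) =
  subst (suc ∣ p ∪ q ∣ ≤_) (sym (ℕ.+-suc ∣ p ∣ ∣ q ∣)) (s≤s (∣p∪q∣≤∣p∣+∣q∣ p q))
∣p∪q∣≤∣p∣+∣q∣ (inside  ∷ p) (outside ∷ q) = s≤s (∣p∪q∣≤∣p∣+∣q∣ p q)
∣p∪q∣≤∣p∣+∣q∣ (inside  ∷ p) (inside  ∷ q) = s≤s (ℕ.≤-trans (∣p∪q∣≤∣p∣+∣q∣ p q)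
  (ℕ.+-monoʳ-≤ ∣ p ∣ (ℕ.n≤1+n ∣ q ∣)))

∣p∣≤1+∣p-x∣ : ∀ (p : Subset n) x → ∣ p ∣ ≤ suc ∣ p - x ∣
∣p∣≤1+∣p-x∣ p x = ℕ.≤-trans (p⊆q⇒∣p∣≤∣q∣ p⊆) (subst (λ k → ∣ ⁅ x ⁆ ∪ (p - x) ∣ ≤ k + ∣ p - x ∣)
  (∣⁅x⁆∣≡1 x) (∣p∪q∣≤∣p∣+∣q∣ ⁅ x ⁆ (p - x)))
  where
  p⊆ : p ⊆ ⁅ x ⁆ ∪ (p - x)
  p⊆ {y} y∈ with y Fin.≟ x
  ... | yes refl = x∈p∪q⁺ (inj₁ (x∈⁅x⁆ x))
  ... | no  y≢x  = x∈p∪q⁺ (inj₂ (x∈p∧x≢y⇒x∈p-y y∈ y≢x))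

x∈p⇒∣p∣≡1+∣p-x∣ : x ∈ p → ∣ p ∣ ≡ suc ∣ p - x ∣
x∈p⇒∣p∣≡1+∣p-x∣ {x = x} {p = p} x∈p =
  ℕ.≤-antisym (∣p∣≤1+∣p-x∣ p x) (x∈p⇒∣p-x∣<∣p∣ x∈p)

⊈⇒∃ : ¬ (p ⊆ q) → ∃[ x ] x ∈ p × x ∉ q
⊈⇒∃ {p = p} {q} p⊈q with Fin.any? (λ x → (x ∈? p) ×-dec ¬? (x ∈? q))
... | yes found = found
... | no  none  = contradiction
  (λ {x} x∈p → decidable-stable (x ∈? q) λ x∉q → none (x , x∈p , x∉q)) p⊈q

∣p∣<∣q∣⇒∃ : ∣ p ∣ < ∣ q ∣ → ∃[ x ] x ∈ q × x ∉ p
∣p∣<∣q∣⇒∃ p<q = ⊈⇒∃ λ q⊆p → ℕ.<⇒≱ p<q (p⊆q⇒∣p∣≤∣q∣ q⊆p)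

p⊆q∧∣q∣≤∣p∣⇒q⊆p : p ⊆ q → ∣ q ∣ ≤ ∣ p ∣ → q ⊆ p
p⊆q∧∣q∣≤∣p∣⇒q⊆p {p = p} {q} p⊆q q≤p with q ⊆? p
... | yes q⊆p = q⊆p
... | no  q⊈p = contradiction (p⊂q⇒∣p∣<∣q∣ ((λ {x} → p⊆q {x}) , ⊈⇒∃ q⊈p)) (ℕ.≤⇒≯ q≤p)

p⊆q∧∣q∣≤∣p∣⇒p≡q : p ⊆ q → ∣ q ∣ ≤ ∣ p ∣ → p ≡ q
p⊆q∧∣q∣≤∣p∣⇒p≡q p⊆q q≤p = ⊆-antisym p⊆q (p⊆q∧∣q∣≤∣p∣⇒q⊆p p⊆q q≤p)

⊆∧≢⇒∣p∣<∣q∣ : p ⊆ q → p ≢ q → ∣ p ∣ < ∣ q ∣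
⊆∧≢⇒∣p∣<∣q∣ p⊆q p≢q = ℕ.≰⇒> λ q≤p → p≢q (p⊆q∧∣q∣≤∣p∣⇒p≡q p⊆q q≤p)

0<∣p∣⇒Nonempty : 0 < ∣ p ∣ → Nonempty p
0<∣p∣⇒Nonempty {n} {p} 0<p with nonempty? p
... | yes ne = ne
... | no  em rewrite Empty-unique em | ∣⊥∣≡0 n = contradiction 0<p ℕ.n≮0

2≤∣p∣⇒∃≢ : 2 ≤ ∣ p ∣ → ∀ x → ∃[ y ] y ∈ p × y ≢ x
2≤∣p∣⇒∃≢ {p = p} 2≤p x =
  let y , y∈ = 0<∣p∣⇒Nonempty (ℕ.≤-pred (ℕ.≤-trans 2≤p (∣p∣≤1+∣p-x∣ p x)))
  in y , p-x⊆p p x y∈ , y∈p-x⇒y≢x y∈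

3≤∣p∣⇒∃≢≢ : 3 ≤ ∣ p ∣ → ∀ x y → ∃[ z ] z ∈ p × z ≢ x × z ≢ y
3≤∣p∣⇒∃≢≢ {p = p} 3≤p x y =
  let z , z∈ , z≢y = 2≤∣p∣⇒∃≢ (ℕ.≤-pred (ℕ.≤-trans 3≤p (∣p∣≤1+∣p-x∣ p x))) y
  in z , p-x⊆p p x z∈ , y∈p-x⇒y≢x z∈ , z≢y

∣p∣≤2⇒only : ∣ p ∣ ≤ 2 → u ∈ p → v ∈ p → u ≢ v → ∀ {z} → z ∈ p → z ≡ u ⊎ z ≡ v
∣p∣≤2⇒only {p = p} {u} {v} p≤2 u∈ v∈ u≢v {z} z∈ with z Fin.≟ u | z Fin.≟ v
... | yes z≡u | _       = inj₁ z≡u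
... | no  _   | yes z≡v = inj₂ z≡v
... | no  z≢u | no  z≢v = contradiction p≤2 (ℕ.<⇒≱ 2<p)
  where
  v∈p-u : v ∈ p - u
  v∈p-u = x∈p∧x≢y⇒x∈p-y v∈ (u≢v ∘ sym)
  z∈p-u-v : z ∈ p - u - v
  z∈p-u-v = x∈p∧x≢y⇒x∈p-y (x∈p∧x≢y⇒x∈p-y z∈ z≢u) z≢v
  2<p : 2 < ∣ p ∣
  2<p = ℕ.≤-trans (s≤s (ℕ.≤-trans (s≤s (ℕ.≤-trans (s≤s z≤n) (x∈p⇒∣p-x∣<∣p∣ z∈p-u-v)))
          (x∈p⇒∣p-x∣<∣p∣ v∈p-u))) (x∈p⇒∣p-x∣<∣p∣ u∈)

∣p∣≤3⇒only : ∣ p ∣ ≤ 3 → u ∈ p → v ∈ p → w ∈ p → u ≢ v → u ≢ w → v ≢ w →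
             ∀ {z} → z ∈ p → z ≡ u ⊎ z ≡ v ⊎ z ≡ w
∣p∣≤3⇒only {p = p} {u} {v} {w} p≤3 u∈ v∈ w∈ u≢v u≢w v≢w {z} z∈ with z Fin.≟ u
... | yes z≡u = inj₁ z≡u
... | no  z≢u = inj₂ (∣p∣≤2⇒only (ℕ.≤-pred (ℕ.≤-trans (x∈p⇒∣p-x∣<∣p∣ u∈) p≤3))
  (x∈p∧x≢y⇒x∈p-y v∈ (u≢v ∘ sym)) (x∈p∧x≢y⇒x∈p-y w∈ (u≢w ∘ sym)) v≢w
  (x∈p∧x≢y⇒x∈p-y z∈ z≢u))

⊆-∪ : p ⊆ H → q ⊆ H → p ∪ q ⊆ H
⊆-∪ {p = p} {q = q} p⊆ q⊆ x∈ with x∈p∪q⁻ p q x∈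
... | inj₁ x∈p = p⊆ x∈p
... | inj₂ x∈q = q⊆ x∈q

⁅⁆⊆ : x ∈ p → ⁅ x ⁆ ⊆ p
⁅⁆⊆ {x = x} x∈p y∈ with refl ← x∈⁅y⁆⇒x≡y x y∈ = x∈p

-- Induction on a bound `k` for the room `n ∸ ∣ G ∣` left above `G`: each proper enlargement inside
-- `P` uses some of it up.
facet-above : ∀ {P : Pred (Subset n) 0ℓ} → Decidable P → P G → ∃[ H ] IsFacet P H × G ⊆ H
facet-above {n} {G} {P} P? PG = go (n ℕ.∸ ∣ G ∣) G PG ℕ.≤-refl
  where
  go : ∀ k (G : Subset n) → P G → n ℕ.∸ ∣ G ∣ ≤ k → ∃[ H ] IsFacet P H × G ⊆ H
  go k G PG k≥ with anySubset? (λ H → P? H ×-dec (G ⊂? H))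
  ... | no  none = G , (PG , λ H PH G⊆H → p⊆q∧∣q∣≤∣p∣⇒p≡q G⊆H (ℕ.≮⇒≥ λ G<H →
                     none (H , PH , (λ {x} → G⊆H {x}) , ∣p∣<∣q∣⇒∃ G<H))) , id
  go ℕ.zero G PG k≥ | yes (H , PH , G⊂H) = contradiction
    (ℕ.m∸n≡0⇒m≤n (ℕ.n≤0⇒n≡0 k≥))
    (ℕ.<⇒≱ (ℕ.<-≤-trans (p⊂q⇒∣p∣<∣q∣ G⊂H) (∣p∣≤n H)))
  go (suc k) G PG k≥ | yes (H , PH , G⊂H) =
    let J , facet , H⊆J = go k H PH (ℕ.≤-pred
          (ℕ.≤-trans (ℕ.∸-monoʳ-< (p⊂q⇒∣p∣<∣q∣ G⊂H) (∣p∣≤n H)) k≥))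
    in J , facet , H⊆J ∘ proj₁ G⊂H

-- Shellings as attachment sequences

Covered : List (Subset n) → Pred (Subset n) 0ℓ
Covered D G = Any (λ F → G ⊆ F) D

-- The faces of `F` in `C` are generated by ridges `F - v`. For an empty `C` this is vacuous, so the
-- first facet of a shelling needs no exception.
Attaches : Pred (Subset n) 0ℓ → Pred (Subset n) 0ℓ
Attaches C F = ∀ G → G ⊆ F → C G → ∃[ v ] v ∈ F × G ⊆ F - v × C (F - v)

-- The newest facet comes first.

data Shelled {n : ℕ} : List (Subset n) → Set where
  []  : Shelled []
  _∷_ : Attaches (Covered D) F → Shelled D → Shelled (F ∷ D)

Attaches-resp : ∀ {C C′ : Pred (Subset n) 0ℓ} → (∀ {G} → C G → C′ G) → (∀ {G} → C′ G → C G) →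
                Attaches C F → Attaches C′ F
Attaches-resp to from att G G⊆F C′G =
  let v , v∈F , G⊆F-v , c = att G G⊆F (from C′G) in v , v∈F , (λ {x} → G⊆F-v {x}) , to c

dim-pred : v ∈ F → dim F ℤ.- 1ℤ ≡ dim (F - v)
dim-pred {F = F} v∈F rewrite x∈p⇒∣p∣≡1+∣p-x∣ v∈F = refl

dim-mono : ∀ (F G : Subset n) → ∣ F ∣ ≤ ∣ G ∣ → dim F ℤ.≤ dim G
dim-mono _ _ F≤G = ℤ.+-monoˡ-≤ (ℤ.- 1ℤ) (ℤ.+≤+ F≤G)

dim-cancel : ∀ (F G : Subset n) → dim F ℤ.≤ dim G → ∣ F ∣ ≤ ∣ G ∣
dim-cancel F G F≤G = ℕ.≮⇒≥ λ G<F →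
  ℤ.<⇒≱ (ℤ.+-monoˡ-< (ℤ.- 1ℤ) (ℤ.+<+ G<F)) F≤G

module _ {C : Pred (Subset n) 0ℓ} {F : Subset n} where

  private
    I : Pred (Subset n) 0ℓ
    I G = C G × simplex F G

  -- Every face of `I` lies in a ridge of `F` belonging to `I`, so the facets of `I` are ridges.
  -- Applied to the empty face, `C ⊥` yields one ridge, which realises the dimension.
  attaches⇒pure : C ⊥ → Attaches C F → IsPure I × HasDimension I (dim F ℤ.- 1ℤ)
  attaches⇒pure C⊥ att =
    let v , v∈F , _ , C-v = att ⊥ ⊥⊆ C⊥ in
    (λ G H facet-G facet-H → trans (dim-facet facet-G) (sym (dim-facet facet-H))) ,
    (F - v , (C-v , p-x⊆p F v) , sym (dim-pred v∈F)) , dim-≤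
    where
    dim-facet : IsFacet I G → dim G ≡ dim F ℤ.- 1ℤ
    dim-facet ((CG , G⊆F) , maximal) =
      let v , v∈F , G⊆F-v , C-v = att _ G⊆F CG in
      trans (cong dim (maximal (F - v) (C-v , p-x⊆p F v) G⊆F-v)) (sym (dim-pred v∈F))

    dim-≤ : ∀ G → I G → dim G ℤ.≤ dim F ℤ.- 1ℤ
    dim-≤ G (CG , G⊆F) =
      let v , v∈F , G⊆F-v , C-v = att _ G⊆F CG in
      subst (dim G ℤ.≤_) (sym (dim-pred v∈F)) (dim-mono G (F - v) (p⊆q⇒∣p∣≤∣q∣ G⊆F-v))

  -- Enlarge `G` to a facet `H` of `I`. The face `E` of top dimension is a facet too, so purity
  -- gives `H` one vertex fewer than `F`, and `H` is `F - v` for any `v` of `F` outside it.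
  pure⇒attaches : Decidable C → IsPure I → HasDimension I (dim F ℤ.- 1ℤ) → Attaches C F
  pure⇒attaches C? pure ((E , IE , dim-E) , dim-≤) G G⊆F CG
    with H , (facet-H@((CH , H⊆F) , _)) , G⊆H ←
           facet-above (λ G → C? G ×-dec (G ⊆? F)) (CG , (λ {x} → G⊆F {x})) =
    conclude (∣p∣<∣q∣⇒∃ H<F)
    where
    facet-E : IsFacet I E
    facet-E = IE , λ G IG E⊆G → p⊆q∧∣q∣≤∣p∣⇒p≡q E⊆G
      (dim-cancel G E (subst (dim G ℤ.≤_) (sym dim-E) (dim-≤ G IG)))
    dim-H : dim H ≡ dim F ℤ.- 1ℤ
    dim-H = trans (pure H E facet-H facet-E) dim-E
    H<F : ∣ H ∣ < ∣ F ∣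
    H<F = ℕ.≰⇒> λ F≤H → ℤ.<⇒≱ (pred-< (dim F))
      (subst (dim F ℤ.≤_) dim-H (dim-mono F H F≤H))
      where
      pred-< : ∀ i → i ℤ.- 1ℤ ℤ.< i
      pred-< i = ℤ.i≤pred[j]⇒i<j (ℤ.≤-reflexive (ℤ.+-comm i ℤ.-1ℤ))
    conclude : ∃[ v ] v ∈ F × v ∉ H → ∃[ v ] v ∈ F × G ⊆ F - v × C (F - v)
    conclude (v , v∈F , v∉H) =
      v , v∈F , (λ {x} → ⊆-remove G⊆F (v∉H ∘ G⊆H) {x}) , subst C H≡F-v CH
      where
      H≡F-v : H ≡ F - v
      H≡F-v = p⊆q∧∣q∣≤∣p∣⇒p≡q (⊆-remove H⊆F v∉H)
        (dim-cancel (F - v) H (ℤ.≤-reflexive (trans (sym (dim-pred v∈F)) (sym dim-H))))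

-- The invariant of the accumulating reversal `_ʳ++_`: facets move from the front of `Fs` into `D`,
-- while the faces available at a given facet stay the same.
Before : List (Subset n) → (Fs : List (Subset n)) → Fin (length Fs) → Pred (Subset n) 0ℓ
Before D Fs k G = Covered D G ⊎ earlier Fs k G

Before-suc⁺ : ∀ D F (Fs : List (Subset n)) k → Before D (F ∷ Fs) (suc k) G → Before (F ∷ D) Fs k G
Before-suc⁺ D F Fs k (inj₁ c)                   = inj₁ (there c)
Before-suc⁺ D F Fs k (inj₂ (zero , _ , G⊆F))    = inj₁ (here G⊆F)
Before-suc⁺ D F Fs k (inj₂ (suc i , s<s i<k , G⊆)) = inj₂ (i , i<k , (λ {x} → G⊆ {x}))

Before-suc⁻ : ∀ D F (Fs : List (Subset n)) k → Before (F ∷ D) Fs k G → Before D (F ∷ Fs) (suc k) G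
Before-suc⁻ D F Fs k (inj₁ (here G⊆F))     = inj₂ (zero , z<s , (λ {x} → G⊆F {x}))
Before-suc⁻ D F Fs k (inj₁ (there c))      = inj₁ c
Before-suc⁻ D F Fs k (inj₂ (i , i<k , G⊆)) = inj₂ (suc i , s<s i<k , (λ {x} → G⊆ {x}))

Before-zero : ∀ D F (Fs : List (Subset n)) → Before D (F ∷ Fs) zero G → Covered D G
Before-zero D F Fs (inj₁ c) = c

Before-[] : ∀ (Fs : List (Subset n)) k → Before [] Fs k G → earlier Fs k G
Before-[] Fs k (inj₂ e) = e

ʳ++-shelled⁺ : ∀ Fs → Shelled D → (∀ k → Attaches (Before D Fs k) (lookup Fs k)) →
               Shelled (Fs ʳ++ D)
ʳ++-shelled⁺ []                 sh att = sh
ʳ++-shelled⁺ {D = D} (F ∷ Fs) sh att = ʳ++-shelled⁺ Fs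
  (Attaches-resp (λ {G} → Before-zero {G = G} D F Fs) inj₁ (att zero) ∷ sh)
  λ k → Attaches-resp (λ {G} → Before-suc⁺ {G = G} D F Fs k) (Before-suc⁻ D F Fs k) (att (suc k))

ʳ++-shelled⁻ : ∀ Fs → Shelled (Fs ʳ++ D) →
               Shelled D × (∀ k → Attaches (Before D Fs k) (lookup Fs k))
ʳ++-shelled⁻ []                 sh = sh , λ ()
ʳ++-shelled⁻ {D = D} (F ∷ Fs) sh with ʳ++-shelled⁻ Fs sh
... | att₀ ∷ sh′ , att = sh′ , λ
  { zero    → Attaches-resp inj₁ (λ {G} → Before-zero {G = G} D F Fs) att₀
  ; (suc k) → Attaches-resp (λ {G} → Before-suc⁻ {G = G} D F Fs k) (Before-suc⁺ D F Fs k) (att k) }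

-- A repeated `F` would be covered by its older copy, and attaching along `F` itself would put `F`
-- inside some `F - v`.
Shelled⇒Unique : Shelled D → Unique D
Shelled⇒Unique []                     = []
Shelled⇒Unique (_∷_ {F = F} att sh) =
  All.tabulate (λ {G} G∈D → λ { refl → contradiction G∈D F∉D }) ∷ Shelled⇒Unique sh
  where
  F∉D : ¬ F List.∈ _
  F∉D F∈D with v , v∈F , F⊆F-v , _ ← att F id (Any.map ⊆-reflexive F∈D) = x∉p-x F v (F⊆F-v v∈F)

ListsFacets : SimplicialComplex n → List (Subset n) → Set
ListsFacets K D =
  (∀ {F} → F List.∈ D → IsFacet (Face K) F) × (∀ {F} → IsFacet (Face K) F → F List.∈ D)

shellable⁺ : (K : SimplicialComplex n) → Shelled D → ListsFacets K D → Shellable K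
shellable⁺ {n} {D} K sh (facet , complete) = reverse D , record
  { unique = Permutation.Unique-resp-↭ (setoid (Subset n))
      (↭⇒↭ₛ (↭-sym (↭-reverse D))) (Shelled⇒Unique sh)
  ; facets = λ F → mk⇔ (facet ∘ Any.reverse⁻) (Any.reverse⁺ ∘ complete)
  ; attach = λ k 0<k → attaches⇒pure (⊥-earlier (reverse D) k 0<k)
      (Attaches-resp (Before-[] (reverse D) k) inj₂ (proj₂ sh⁻ k))
  }
  where
  sh⁻ : Shelled [] × (∀ k → Attaches (Before [] (reverse D) k) (lookup (reverse D) k))
  sh⁻ = ʳ++-shelled⁻ (reverse D) (subst Shelled (sym (reverse-involutive D)) sh)

  ⊥-earlier : ∀ (Fs : List (Subset n)) k → 0 < toℕ k → earlier Fs k ⊥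
  ⊥-earlier (_ ∷ _) (suc k) _ = zero , z<s , ⊥⊆

shellable⁻ : (K : SimplicialComplex n) → Shellable K → ∃[ D ] Shelled D × ListsFacets K D
shellable⁻ {n} K (Fs , shelling) =
  reverse Fs , ʳ++-shelled⁺ Fs [] att ,
  (λ F∈ → Equivalence.to (facets _) (Any.reverse⁻ F∈)) ,
  (λ facet → Any.reverse⁺ (Equivalence.from (facets _) facet))
  where
  open IsShelling shelling
  earlier? : ∀ k → Decidable (earlier Fs k)
  earlier? k G = Fin.any? λ i → (i Fin.<? k) ×-dec (G ⊆? lookup Fs i)
  attaches : ∀ k → Attaches (earlier Fs k) (lookup Fs k)
  attaches k with 0 ℕ.<? toℕ k
  ... | yes 0<k = pure⇒attaches (earlier? k) (proj₁ (attach k 0<k)) (proj₂ (attach k 0<k))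
  ... | no  0≮k = λ { _ _ (i , i<k , _) → contradiction (ℕ.≤-trans (s≤s z≤n) i<k) 0≮k }
  att : ∀ k → Attaches (Before [] Fs k) (lookup Fs k)
  att k = Attaches-resp inj₂ (λ {G} → Before-[] {G = G} Fs k) (attaches k)

-- Shellings of the large facets and strong connectivity.

size≥? : ∀ m → Decidable (λ (F : Subset n) → m ≤ ∣ F ∣)
size≥? m F = m ℕ.≤? ∣ F ∣

upper : ℕ → List (Subset n) → List (Subset n)
upper m = filter (size≥? m)

-- An earlier facet G covering the ridge F - v cannot equal F - v, so it is at least
-- as large as F and survives the filter.

filter-shelled : ∀ m → Shelled D → (∀ {F G} → F List.∈ D → G List.∈ D → F ⊆ G → F ≡ G) →
                 Shelled (upper m D)
filter-shelled m []                              _    = []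
filter-shelled m (_∷_ {D = D} {F = F} att sh) anti with size≥? m F
... | no  m≰F = subst Shelled (sym (filter-reject (size≥? m) m≰F)) sh′
  where sh′ = filter-shelled m sh (λ F∈ G∈ → anti (there F∈) (there G∈))
... | yes m≤F = subst Shelled (sym (filter-accept (size≥? m) m≤F)) (att′ ∷ sh′)
  where
  sh′ = filter-shelled m sh (λ F∈ G∈ → anti (there F∈) (there G∈))

  m≤ : v ∈ F → G List.∈ D → F - v ⊆ G → m ≤ ∣ G ∣
  m≤ {v} {G} v∈F G∈D F-v⊆G = ℕ.≤-trans m≤F
    (subst (_≤ ∣ G ∣) (sym (x∈p⇒∣p∣≡1+∣p-x∣ v∈F)) (⊆∧≢⇒∣p∣<∣q∣ F-v⊆G F-v≢G))
    where
    F-v≢G : F - v ≢ G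
    F-v≢G refl = x∉p-x F v (subst (v ∈_) (sym (anti (there G∈D) (here refl) (p-x⊆p F v))) v∈F)

  att′ : Attaches (Covered (upper m D)) F
  att′ G G⊆F c with v , v∈F , G⊆F-v , c′ ← att G G⊆F (Any.filter⁻ (size≥? m) c) with List.find c′
  ... | J , J∈D , F-v⊆J = v , v∈F , (λ {x} → G⊆F-v {x}) ,
    List.lose (List.∈-filter⁺ (size≥? m) J∈D (m≤ v∈F J∈D F-v⊆J)) F-v⊆J

-- A place where a path of adjacent facets around `G` leaves `C`. The bound `m≤` gives the ridge at
-- least `m` minus one vertices: an edge for `m = 3`, a vertex for `m = 2`.
record Crossing (D : List (Subset n)) (C : Pred (Subset n) 0ℓ) (G : Subset n) (m : ℕ) : Set where
  field
    {near far ridge} : Subset n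
    near∈    : near List.∈ D
    far∈     : far List.∈ D
    C-near   : C near
    ¬C-far   : ¬ C far
    G⊆       : G ⊆ ridge
    ⊆near    : ridge ⊆ near
    ⊆far     : ridge ⊆ far
    m≤       : m ≤ suc ∣ ridge ∣

crossing-weaken : ∀ {C} → Crossing D C G m → Crossing (F ∷ D) C G m
crossing-weaken c = record { Crossing c ; near∈ = there near∈ ; far∈ = there far∈ }
  where open Crossing c

-- The link of G in a shelled complex is strongly connected.

crossing : ∀ {C : Pred (Subset n) 0ℓ} → Decidable C → Shelled D → (∀ {F} → F List.∈ D → m ≤ ∣ F ∣) →
           p List.∈ D → q List.∈ D → G ⊆ p → G ⊆ q → C p → ¬ C q → Crossing D C G m
crossing C? (att ∷ sh) m≤ (here refl) (here refl) G⊆p G⊆q Cp ¬Cq = contradiction Cp ¬Cq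
crossing C? (att ∷ sh) m≤ (there p∈) (there q∈) G⊆p G⊆q Cp ¬Cq =
  crossing-weaken (crossing C? sh (m≤ ∘ there) p∈ q∈ G⊆p G⊆q Cp ¬Cq)
-- As `q` covers `G`, the newest facet `p` shares a ridge above `G` with an older `J`. Either `C` is
-- lost right there, or the search goes on from `J` among the older facets.
crossing {p = p} C? (att ∷ sh) m≤ (here refl) (there q∈) G⊆p G⊆q Cp ¬Cq
  with v , v∈ , G⊆ , c ← att _ G⊆p (List.lose q∈ G⊆q) with List.find c
... | J , J∈ , ⊆J with C? J
...   | yes CJ = crossing-weaken (crossing C? sh (m≤ ∘ there) J∈ q∈ (⊆J ∘ G⊆) G⊆q CJ ¬Cq)
...   | no ¬CJ = record
  { near∈ = here refl ; far∈ = there J∈ ; C-near = Cp ; ¬C-far = ¬CJ ; G⊆ = G⊆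
  ; ⊆near = p-x⊆p p v ; ⊆far = ⊆J ; m≤ = ℕ.≤-trans (m≤ (here refl)) (∣p∣≤1+∣p-x∣ p v) }
crossing {q = q} C? (att ∷ sh) m≤ (there p∈) (here refl) G⊆p G⊆q Cp ¬Cq
  with v , v∈ , G⊆ , c ← att _ G⊆q (List.lose p∈ G⊆p) with List.find c
... | J , J∈ , ⊆J with C? J
...   | no ¬CJ = crossing-weaken (crossing C? sh (m≤ ∘ there) p∈ J∈ G⊆p (⊆J ∘ G⊆) Cp ¬CJ)
...   | yes CJ = record
  { near∈ = there J∈ ; far∈ = here refl ; C-near = CJ ; ¬C-far = ¬Cq ; G⊆ = G⊆
  ; ⊆near = ⊆J ; ⊆far = p-x⊆p q v ; m≤ = ℕ.≤-trans (m≤ (here refl)) (∣p∣≤1+∣p-x∣ q v) }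

-- Cocycles modulo 2 on shelled facets

Cocycle : (Fin n → Fin n → Bool) → Pred (Subset n) 0ℓ
Cocycle φ F = ∀ {u v w} → u ∈ F → v ∈ F → w ∈ F → φ u v xor φ v w ≡ φ u w

Coboundary : (Fin n → Fin n → Bool) → (Fin n → Bool) → Pred (Subset n) 0ℓ
Coboundary φ f F = ∀ {u v} → u ∈ F → v ∈ F → φ u v ≡ f u xor f v

xor-cancelʳ : ∀ a b → (a xor b) xor b ≡ a
xor-cancelʳ a b = trans (xor-assoc a b b) (trans (cong (a xor_) (xor-same b)) (xor-identityʳ a))

-- Modulo 2 the cocycle identity reads `φ u v ≡ φ u y xor φ v y`, so it is enough to test a
-- potential on pairs ending at one base vertex.
coboundary-from : ∀ {φ} (f : Fin n → Bool) → Cocycle φ F → y ∈ F →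
                  (∀ {a} → a ∈ F → φ a y ≡ f a xor f y) → Coboundary φ f F
coboundary-from {y = y} {φ} f cocycle y∈ φ≡ {u} {v} u∈ v∈ =
  trans (sym (xor-cancelʳ (φ u v) (φ v y)))
  (trans (cong₂ _xor_ (trans (cocycle u∈ v∈ y∈) (φ≡ u∈)) (φ≡ v∈)) (lemma (f u) (f v) (f y)))
  where
  lemma : ∀ a b c → (a xor c) xor (b xor c) ≡ a xor b
  lemma false b c = trans (xor-comm c (b xor c)) (xor-cancelʳ b c)
  lemma true  b false = cong not (xor-identityʳ b)
  lemma true  false true = refl
  lemma true  true true = refl

-- A new facet all of whose vertices are old meets the old ones in two ridges,
-- and these determine the potential on it; otherwise its only new vertex is free.

potential : ∀ φ → Shelled D → (∀ {F} → F List.∈ D → 3 ≤ ∣ F ∣) →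
            (∀ {F} → F List.∈ D → Cocycle φ F) →
            ∃[ f ] (∀ {F} → F List.∈ D → Coboundary φ f F)
potential φ []         3≤ cocycle = (λ _ → false) , λ ()
potential φ (_∷_ {D = []} {F} att sh) 3≤ cocycle =
  let y , y∈ = 0<∣p∣⇒Nonempty (ℕ.≤-trans (s≤s z≤n) (3≤ (here refl)))
      φyy = trans (sym (cocycle (here refl) y∈ y∈ y∈)) (xor-same (φ y y))
  in (λ a → φ a y) , λ { (here refl) → 
       coboundary-from (λ a → φ a y) (cocycle (here refl)) y∈ λ {a} a∈ →
     trans (sym (xor-identityʳ (φ a y))) (cong (φ a y xor_) (sym φyy)) }
potential {n} φ (_∷_ {D = D@(_ ∷ _)} {F} att sh) 3≤ cocycle
  with f , cob ← potential φ sh (3≤ ∘ there) (cocycle ∘ there)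
     | v , v∈ , _ , F-v-covered ← att ⊥ ⊥⊆ (here ⊥⊆)
  with any? (v ∈?_) D
... | yes v-old
  -- The old vertex `v` lies in a second old ridge `F - w`. For a third vertex `y`, that ridge
  -- contains `v` and `y`, while `F - v` contains all other pairs ending at `y`.
  with w , w∈ , v⊆ , F-w-covered ← att ⁅ v ⁆ (⁅⁆⊆ v∈) (Any.map ⁅⁆⊆ v-old)
  with y , y∈ , y≢v , y≢w ← 3≤∣p∣⇒∃≢≢ (3≤ (here refl)) v w = f , λ
  { (here refl) → coboundary-from f (cocycle (here refl)) y∈ λ {a} a∈ → go a∈ (a Fin.≟ v)
  ; (there F∈)  → cob F∈ }
  where
  go : ∀ {a} → a ∈ F → Dec (a ≡ v) → φ a y ≡ f a xor f y
  go a∈ (yes refl) with J , J∈ , ⊆J ← List.find F-w-covered =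
    cob J∈ (⊆J (v⊆ (x∈⁅x⁆ v))) (⊆J (x∈p∧x≢y⇒x∈p-y y∈ y≢w))
  go a∈ (no a≢v) with J , J∈ , ⊆J ← List.find F-v-covered =
    cob J∈ (⊆J (x∈p∧x≢y⇒x∈p-y a∈ a≢v)) (⊆J (x∈p∧x≢y⇒x∈p-y y∈ y≢v))
... | no v-new with y , y∈ , y≢v ← 2≤∣p∣⇒∃≢ (ℕ.≤-trans (s≤s (s≤s z≤n)) (3≤ (here refl))) v = f′ , λ
  { (here refl) → coboundary-from f′ (cocycle (here refl)) y∈ λ {a} a∈ → go a∈ (a Fin.≟ v)
  ; (there J∈) {a} {b} a∈ b∈ → trans (cob J∈ a∈ b∈) (cong₂ _xor_
      (sym (f′-old λ { refl → v-new (List.lose J∈ a∈) }))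
      (sym (f′-old λ { refl → v-new (List.lose J∈ b∈) }))) }
  where
  f′ : Fin n → Bool
  f′ a with a Fin.≟ v
  -- The value that the pair `v`, `y` forces.
  ... | yes _ = φ v y xor f y
  ... | no  _ = f a
  f′-old : ∀ {a} → a ≢ v → f′ a ≡ f a
  f′-old {a} a≢v with a Fin.≟ v
  ... | yes a≡v = contradiction a≡v a≢v
  ... | no  _   = refl
  f′-new : f′ v ≡ φ v y xor f y
  f′-new with v Fin.≟ v
  ... | yes _   = refl
  ... | no  v≢v = contradiction refl v≢v
  go : ∀ {a} → a ∈ F → Dec (a ≡ v) → φ a y ≡ f′ a xor f′ y
  go a∈ (yes refl) = sym (trans (cong₂ _xor_ f′-new (f′-old y≢v)) (xor-cancelʳ (φ v y) (f y)))
  go a∈ (no a≢v) with J , J∈ , ⊆J ← List.find F-v-covered =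
    trans (cob J∈ (⊆J (x∈p∧x≢y⇒x∈p-y a∈ a≢v)) (⊆J (x∈p∧x≢y⇒x∈p-y y∈ y≢v)))
      (cong₂ _xor_ (sym (f′-old a≢v)) (sym (f′-old y≢v)))

-- Extending partial shellings

_≟ₛ_ : (F G : Subset n) → Dec (F ≡ G)
_≟ₛ_ = Vec.≡-dec Bool._≟_

_∈ₗ?_ : (F : Subset n) (D : List (Subset n)) → Dec (F List.∈ D)
F ∈ₗ? D = DecMembership._∈?_ _≟ₛ_ F D

subsets : ∀ n → List (Subset n)
subsets ℕ.zero  = [] ∷ []
subsets (suc n) = map (outside ∷_) (subsets n) ++ map (inside ∷_) (subsets n)

∈-subsets : ∀ (F : Subset n) → F List.∈ subsets n
∈-subsets []            = here refl
∈-subsets (outside ∷ F) = List.∈-++⁺ˡ (List.∈-map⁺ (outside ∷_) (∈-subsets F))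
∈-subsets (inside  ∷ F) =
  List.∈-++⁺ʳ (map (outside ∷_) (subsets _)) (List.∈-map⁺ (inside ∷_) (∈-subsets F))

module _ {A : Set} {P Q : Pred A 0ℓ} (P? : Decidable P) (Q? : Decidable Q)
         (P⇒Q : ∀ {x} → P x → Q x) where

  length-filter-≤ : ∀ xs → length (filter P? xs) ≤ length (filter Q? xs)
  length-filter-≤ []       = z≤n
  length-filter-≤ (x ∷ xs) with P? x | Q? x
  ... | yes _ | yes _  = s≤s (length-filter-≤ xs)
  ... | yes p | no  ¬q = contradiction (P⇒Q p) ¬q
  ... | no  _ | yes _  = ℕ.m≤n⇒m≤1+n (length-filter-≤ xs)
  ... | no  _ | no  _  = length-filter-≤ xs

  length-filter-< : ∀ {x xs} → x List.∈ xs → Q x → ¬ P x →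
                    length (filter P? xs) < length (filter Q? xs)
  length-filter-< {x} {_ ∷ xs} (here refl) q ¬p with P? x | Q? x
  ... | yes p | _      = contradiction p ¬p
  ... | no  _ | yes _  = s≤s (length-filter-≤ xs)
  ... | no  _ | no  ¬q = contradiction q ¬q
  length-filter-< {xs = y ∷ xs} (there x∈) q ¬p with P? y | Q? y
  ... | yes _ | yes _  = s≤s (length-filter-< x∈ q ¬p)
  ... | yes p | no  ¬q = contradiction (P⇒Q p) ¬q
  ... | no  _ | yes _  = ℕ.m≤n⇒m≤1+n (length-filter-< x∈ q ¬p)
  ... | no  _ | no  _  = length-filter-< x∈ q ¬p

module _ {P : Pred (List (Subset n)) 0ℓ} {Q : Pred (Subset n) 0ℓ} (Q? : Decidable Q)
         (step : ∀ {D F} → P D → Q F → ¬ F List.∈ D → ∃[ G ] ¬ G List.∈ D × P (G ∷ D)) where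

  -- The set added by `step` may differ from the missing `F`, so the recursion runs on the number of
  -- subsets not yet listed.
  extend : P D → ∃[ E ] P E × (∀ {F} → Q F → F List.∈ E)
  extend PD = go (length (missing _)) PD ℕ.≤-refl
    where
    missing : List (Subset n) → List (Subset n)
    missing D = filter (λ F → ¬? (F ∈ₗ? D)) (subsets n)

    go : ∀ {D} k → P D → length (missing D) ≤ k → ∃[ E ] P E × (∀ {F} → Q F → F List.∈ E)
    go {D} k PD ≤k with anySubset? (λ F → Q? F ×-dec ¬? (F ∈ₗ? D))
    ... | no none = D , PD , λ {F} QF → decidable-stable (F ∈ₗ? D) λ F∉D → none (F , QF , F∉D)
    ... | yes (F , QF , F∉D) with step PD QF F∉D
    ...   | G , G∉D , PGD = descend k ≤k
      where
      fewer : length (missing (G ∷ D)) < length (missing D)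
      fewer = length-filter-< _ _ (λ ∉GD ∈D → ∉GD (there ∈D))
        (∈-subsets G) G∉D (λ ∉GD → ∉GD (here refl))

      descend : ∀ k → length (missing D) ≤ k → ∃[ E ] P E × (∀ {F} → Q F → F List.∈ E)
      descend ℕ.zero  ≤k = contradiction (ℕ.<-≤-trans fewer ≤k) ℕ.n≮0
      descend (suc k) ≤k = go k PGD (ℕ.≤-pred (ℕ.<-≤-trans fewer ≤k))

Attaches? : ∀ {C : Pred (Subset n) 0ℓ} → Decidable C → Decidable (Attaches C)
Attaches? {C = C} C? F = decide (anySubset? (λ G → (G ⊆? F) ×-dec (C? G ×-dec ¬? (ridge? G))))
  where
  Ridge : Pred (Subset _) 0ℓ
  Ridge G = ∃[ v ] v ∈ F × G ⊆ F - v × C (F - v)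

  ridge? : Decidable Ridge
  ridge? G = Fin.any? λ v → (v ∈? F) ×-dec ((G ⊆? (F - v)) ×-dec C? (F - v))

  decide : Dec (∃[ G ] G ⊆ F × C G × ¬ Ridge G) → Dec (Attaches C F)
  decide (yes (G , G⊆F , CG , ¬ridge)) = no λ att → ¬ridge (att G G⊆F CG)
  decide (no none) = yes λ G G⊆F CG → decidable-stable (ridge? G)
    λ ¬ridge → none (G , (λ {x} → G⊆F {x}) , CG , ¬ridge)

Covered? : ∀ (D : List (Subset n)) → Decidable (Covered D)
Covered? D G = any? (G ⊆?_) D

-- Criteria for attaching a facet.

Joined : List (Subset n) → Fin n → Fin n → Set
Joined D u v = Any (λ F → u ∈ F × v ∈ F) D

Joined? : ∀ (D : List (Subset n)) u v → Dec (Joined D u v)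
Joined? D u v = any? (λ F → (u ∈? F) ×-dec (v ∈? F)) D

Joined-sym : Joined D u v → Joined D v u
Joined-sym = Any.map λ (u∈ , v∈) → v∈ , u∈

Joined⇒Covered : Joined D u v → (∀ {z} → z ∈ F → z ≡ u ⊎ z ≡ v) → Covered D F
Joined⇒Covered {F = F} joined only = Any.map (λ {G} (u∈ , v∈) {z} z∈ → go u∈ v∈ (only z∈)) joined
  where
  go : u ∈ G → v ∈ G → z ≡ u ⊎ z ≡ v → z ∈ G
  go u∈ v∈ (inj₁ refl) = u∈
  go u∈ v∈ (inj₂ refl) = v∈

-- No covered face contains `v`, so every covered face of `F` already lies in the single ridge
-- `F - v`.
attaches-new : v ∈ F → Covered D (F - v) → ¬ Any (v ∈_) D → Attaches (Covered D) F
attaches-new {v = v} v∈F c v-new G G⊆F G-covered =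
  v , v∈F , (λ {x} → ⊆-remove G⊆F (λ v∈G → v-new (Any.map (λ G⊆J → G⊆J v∈G) G-covered)) {x}) , c

-- A covered face missing `u` or `w` lies in the covered edge opposite that vertex. One containing
-- both must miss `v`, since `F` is uncovered, and is then itself the ridge `F - v`.
attaches-two : ∣ F ∣ ≤ 3 → ¬ Covered D F → u ∈ F → v ∈ F → w ∈ F → u ≢ v → u ≢ w → v ≢ w →
               Joined D u v → Joined D v w → Attaches (Covered D) F
attaches-two {F = F} {D} {u} {v} {w} F≤3 uncovered u∈ v∈ w∈ u≢v u≢w v≢w uv vw G G⊆F G-covered
  with u ∈? G | w ∈? G
... | no u∉G | _ = u , u∈ , (λ {x} → ⊆-remove G⊆F u∉G {x}) , Joined⇒Covered vw only
  where
  only : z ∈ F - u → z ≡ v ⊎ z ≡ w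
  only z∈ with ∣p∣≤3⇒only F≤3 u∈ v∈ w∈ u≢v u≢w v≢w (p-x⊆p F u z∈)
  ... | inj₁ z≡u = contradiction z≡u (y∈p-x⇒y≢x z∈)
  ... | inj₂ z≡  = z≡
... | yes _ | no w∉G = w , w∈ , (λ {x} → ⊆-remove G⊆F w∉G {x}) , Joined⇒Covered uv only
  where
  only : z ∈ F - w → z ≡ u ⊎ z ≡ v
  only z∈ with ∣p∣≤3⇒only F≤3 u∈ v∈ w∈ u≢v u≢w v≢w (p-x⊆p F w z∈)
  ... | inj₁ z≡u        = inj₁ z≡u
  ... | inj₂ (inj₁ z≡v) = inj₂ z≡v
  ... | inj₂ (inj₂ z≡w) = contradiction z≡w (y∈p-x⇒y≢x z∈)
... | yes u∈G | yes w∈G = v , v∈ , (λ {x} → ⊆-remove G⊆F v∉G {x}) ,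
  Any.map (λ G⊆J {z} z∈ → G⊆J (rest z∈)) G-covered
  where
  v∉G : v ∉ G
  v∉G v∈G = uncovered (Any.map (λ G⊆J {z} z∈ → G⊆J (all z∈)) G-covered)
    where
    all : F ⊆ G
    all z∈ with ∣p∣≤3⇒only F≤3 u∈ v∈ w∈ u≢v u≢w v≢w z∈
    ... | inj₁ refl        = u∈G
    ... | inj₂ (inj₁ refl) = v∈G
    ... | inj₂ (inj₂ refl) = w∈G
  rest : F - v ⊆ G
  rest z∈ with ∣p∣≤3⇒only F≤3 u∈ v∈ w∈ u≢v u≢w v≢w (p-x⊆p F v z∈)
  ... | inj₁ refl        = u∈G
  ... | inj₂ (inj₁ refl) = contradiction refl (y∈p-x⇒y≢x z∈)
  ... | inj₂ (inj₂ refl) = w∈G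

-- If `G` contains `F - y`, it covers that ridge and misses `y`, as `F` is uncovered. Otherwise it
-- misses some `w` other than `y`, and `F - w` has only the old vertex `y`.
attaches-old : ∣ F ∣ ≤ 2 → ¬ Covered D F → y ∈ F → Any (y ∈_) D → Attaches (Covered D) F
attaches-old {F = F} {D} {y} F≤2 uncovered y∈F y-old G G⊆F G-covered with (F - y) ⊆? G
... | yes F-y⊆G = y , y∈F , (λ {x} → ⊆-remove G⊆F y∉G {x}) ,
  Any.map (λ G⊆J {z} z∈ → G⊆J (F-y⊆G z∈)) G-covered
  where
  y∉G : y ∉ G
  y∉G y∈G = uncovered (Any.map (λ G⊆J {z} z∈ → G⊆J (all z∈)) G-covered)
    where
    all : F ⊆ G
    all {z} z∈ with z Fin.≟ y
    ... | yes refl = y∈G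
    ... | no  z≢y  = F-y⊆G (x∈p∧x≢y⇒x∈p-y z∈ z≢y)
... | no F-y⊈G with w , w∈ , w∉G ← ⊈⇒∃ F-y⊈G =
  w , p-x⊆p F y w∈ , (λ {x} → ⊆-remove G⊆F w∉G {x}) , Any.map (λ y∈J {z} z∈ → at-y y∈J z∈) y-old
  where
  at-y : y ∈ H → z ∈ F - w → z ∈ H
  at-y y∈H z∈ with ∣p∣≤2⇒only F≤2 y∈F (p-x⊆p F y w∈) (y∈p-x⇒y≢x w∈ ∘ sym) (p-x⊆p F w z∈)
  ... | inj₁ refl = y∈H
  ... | inj₂ z≡w  = contradiction z≡w (y∈p-x⇒y≢x z∈)

coboundary⇒cocycle : ∀ {φ} (f : Fin n → Bool) → Coboundary φ f F → Cocycle φ F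
coboundary⇒cocycle {φ = φ} f cob {u} {v} {w} u∈ v∈ w∈ =
  trans (cong₂ _xor_ (cob u∈ v∈) (cob v∈ w∈)) (trans (telescope (f u) (f v) (f w)) (sym (cob u∈ w∈)))
  where
  telescope : ∀ a b c → (a xor b) xor (b xor c) ≡ a xor c
  telescope false b c = trans (sym (xor-assoc b b c)) (cong (_xor c) (xor-same b))
  telescope true false c = refl
  telescope true true c = refl

xor-injectiveʳ : ∀ a {b c} → a xor b ≡ a xor c → b ≡ c
xor-injectiveʳ false eq = eq
xor-injectiveʳ true  eq = Bool.not-injective eq

xor≡false⇒≡ : ∀ {a b} → false ≡ a xor b → a ≡ b
xor≡false⇒≡ {a} eq = xor-injectiveʳ a (trans (xor-same a) eq)

-- Local shellings in complexes with faces of at most three vertices.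

module _ (K : SimplicialComplex n)
         (size≤3 : ∀ {F} → Face K F → ∣ F ∣ ≤ 3)
         (7<∣V∣ : 7 < ∣ vertices K ∣)
         (shellable : ∀ U (U⊂V : U ⊂ vertices K) → Shellable (induced K U (proj₁ U⊂V)))
  where

  private
    V : Subset n
    V = vertices K

  Triangle : Pred (Subset n) 0ℓ
  Triangle F = Face K F × 3 ≤ ∣ F ∣

  Triangle? : Decidable Triangle
  Triangle? F = face? K F ×-dec (3 ℕ.≤? ∣ F ∣)

  triangle-facet : Triangle F → IsFacet (Face K) F
  triangle-facet (face , 3≤F) = face , λ G KG F⊆G → p⊆q∧∣q∣≤∣p∣⇒p≡q F⊆G (ℕ.≤-trans (size≤3 KG) 3≤F)

  TriangleShelling : Set
  TriangleShelling = ∃[ D ] Shelled D ×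
    (∀ {F} → F List.∈ D → Triangle F) × (∀ {F} → Triangle F → F List.∈ D)

  uncovered : (∀ {F} → F List.∈ D → Face K F) → IsFacet (Face K) F → ¬ F List.∈ D → ¬ Covered D F
  uncovered faces (_ , maximal) F∉D covered with J , J∈D , F⊆J ← List.find covered =
    F∉D (subst (List._∈ _) (sym (maximal J (faces J∈D) F⊆J)) J∈D)

  -- A listed set is a facet of the induced complex and may fail to be one of `K`, so `sound`
  -- promises only a face. Conversely, a facet of `K` inside `U` stays maximal there, which gives
  -- `complete`.
  record LocalShelling (U : Subset n) (m : ℕ) : Set where
    field
      order    : List (Subset n)
      shelled  : Shelled order
      sound    : ∀ {F} → F List.∈ order → Face K F × F ⊆ U × m ≤ ∣ F ∣
      complete : ∀ {F} → IsFacet (Face K) F → F ⊆ U → m ≤ ∣ F ∣ → F List.∈ order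

  local-shelling : ∀ {U} → U ⊂ V → ∀ m → LocalShelling U m
  local-shelling {U} U⊂V m with shellable⁻ (induced K U (proj₁ U⊂V)) (shellable U U⊂V)
  ... | D , sh , facet , complete′ = record
    { order    = upper m D
    ; shelled  = filter-shelled m sh λ {F} {G} F∈ G∈ F⊆G →
        proj₂ (facet F∈) G (proj₁ (facet G∈)) F⊆G
    ; sound    = λ F∈ → let F∈D , m≤F = List.∈-filter⁻ (size≥? m) F∈
                            KF , F⊆U = proj₁ (facet F∈D) in KF , (λ {x} → F⊆U {x}) , m≤F
    ; complete = λ { (KF , maximal) F⊆U m≤F → List.∈-filter⁺ (size≥? m)
        (complete′ ((KF , (λ {x} → F⊆U {x})) , λ { G (KG , _) F⊆G → maximal G KG F⊆G })) m≤F }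
    }

  -- Here the number of vertices of `K` enters: at most seven vertices always induce a proper, hence
  -- shellable, subcomplex.
  small⇒⊂ : ∀ {U} → U ⊆ V → ∣ U ∣ ≤ 7 → U ⊂ V
  small⇒⊂ U⊆V U≤7 = (λ {x} → U⊆V {x}) , ∣p∣<∣q∣⇒∃ (ℕ.≤-<-trans U≤7 7<∣V∣)

  ∪-face⊂ : Face K F → Face K G → F ∪ G ⊂ V
  ∪-face⊂ {F} {G} KF KG = small⇒⊂ (⊆-∪ (face⊆ K KF) (face⊆ K KG))
    (ℕ.m≤n⇒m≤1+n (ℕ.≤-trans (∣p∪q∣≤∣p∣+∣q∣ F G) (ℕ.+-mono-≤ (size≤3 KF) (size≤3 KG))))

  -- The value 3 of `m` compares triangles with each other; 2 is for connecting an edge facet to a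
  -- triangle.
  facet-crossing : ∀ m {C} → Decidable C → ∀ {p q} → IsFacet (Face K) p → IsFacet (Face K) q →
                   m ≤ ∣ p ∣ → m ≤ ∣ q ∣ → G ⊆ p → G ⊆ q → C p → ¬ C q →
                   ∃[ D ] (∀ {F} → F List.∈ D → Face K F × F ⊆ p ∪ q × m ≤ ∣ F ∣) × Crossing D C G m
  facet-crossing m C? {p} {q} facet-p facet-q m≤p m≤q G⊆p G⊆q Cp ¬Cq =
    order , sound , crossing C? shelled (λ F∈ → proj₂ (proj₂ (sound F∈)))
      (complete facet-p (p⊆p∪q q) m≤p) (complete facet-q (q⊆p∪q p q) m≤q) G⊆p G⊆q Cp ¬Cq
    where open LocalShelling (local-shelling (∪-face⊂ (proj₁ facet-p) (proj₁ facet-q)) m)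

  triangle-crossing : ∀ {C} → Decidable C → ∀ {p q} → Triangle p → Triangle q →
                      G ⊆ p → G ⊆ q → C p → ¬ C q →
                      ∃[ D ] (∀ {F} → F List.∈ D → Triangle F × F ⊆ p ∪ q) × Crossing D C G 3
  triangle-crossing C? Tp Tq G⊆p G⊆q Cp ¬Cq =
    let D , sound , c = facet-crossing 3 C? (triangle-facet Tp) (triangle-facet Tq)
                          (proj₂ Tp) (proj₂ Tq) G⊆p G⊆q Cp ¬Cq
    in D , (λ F∈ → let KF , F⊆ , 3≤F = sound F∈ in (KF , 3≤F) , (λ {x} → F⊆ {x})) , c

  -- If `t` missed the value `f y`, a crossing from `s` to `t` would exist. A vertex of its ridge
  -- has the value `f y` by constancy on the near triangle, yet it lies in the far one.
  constant-on-triangles : ∀ (f : Fin n → Bool) {s t y z} → Triangle s → Triangle t →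
    (∀ {F u v} → Triangle F → F ⊆ s ∪ t → u ∈ F → v ∈ F → f u ≡ f v) → y ∈ s → z ∈ t → f y ≡ f z
  constant-on-triangles f {s} {t} {y} {z} Tₛ Tₜ constant y∈s z∈t = decide (SameAsY? t)
    where
    SameAsY : Pred (Subset n) 0ℓ
    SameAsY F = ∃[ v ] v ∈ F × f y ≡ f v

    SameAsY? : Decidable SameAsY
    SameAsY? F = Fin.any? λ v → (v ∈? F) ×-dec (f y Bool.≟ f v)

    decide : Dec (SameAsY t) → f y ≡ f z
    decide (yes (v , v∈t , fy≡fv)) = trans fy≡fv (constant Tₜ (q⊆p∪q s t) v∈t z∈t)
    decide (no ¬same)
      with _ , sound , c ← triangle-crossing SameAsY? Tₛ Tₜ ⊥⊆ ⊥⊆ (y , y∈s , refl) ¬same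
      with v , v∈near , fy≡fv ← Crossing.C-near c
         | w , w∈ ← 0<∣p∣⇒Nonempty (ℕ.≤-trans (s≤s z≤n) (ℕ.≤-pred (Crossing.m≤ c))) =
      let open Crossing c
          T-near , near⊆ = sound near∈
          fv≡fw = constant T-near near⊆ v∈near (⊆near w∈)
      in contradiction (w , ⊆far w∈ , trans fy≡fv fv≡fw) ¬C-far

  -- Extending a shelling of the triangles avoiding a vertex.

  module _ {t₁ t₀ : Subset n} {x a b : Fin n} (T₁ : Triangle t₁) (T₀ : Triangle t₀)
           (x∈t₁ : x ∈ t₁) (x∉t₀ : x ∉ t₀) (a∈t₁ : a ∈ t₁) (b∈t₁ : b ∈ t₁)
           (a∈t₀ : a ∈ t₀) (b∈t₀ : b ∈ t₀) (b≢a : b ≢ a)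
    where

    private
      ∉⇒≢ : ∀ {y t} → y ∈ t → x ∉ t → y ≢ x
      ∉⇒≢ y∈ x∉ refl = x∉ y∈

      a≢x : a ≢ x
      a≢x = ∉⇒≢ a∈t₀ x∉t₀

      b≢x : b ≢ x
      b≢x = ∉⇒≢ b∈t₀ x∉t₀

      open LocalShelling (local-shelling (x∈p⇒p-x⊂p (face⊆ K (proj₁ T₁) x∈t₁)) 3)
        renaming (order to D₀; shelled to shelled₀; sound to sound₀; complete to complete₀)

      D₀-triangle : F List.∈ D₀ → Triangle F
      D₀-triangle F∈ = let KF , _ , 3≤F = sound₀ F∈ in KF , 3≤F

      D₀-avoids : F List.∈ D₀ → x ∉ F
      D₀-avoids F∈ x∈F = let _ , F⊆ , _ = sound₀ F∈ in x∉p-x V x (F⊆ x∈F)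

      D₀-complete : Triangle F → x ∉ F → F List.∈ D₀
      D₀-complete T x∉F = complete₀ (triangle-facet T) (⊆-remove (face⊆ K (proj₁ T)) x∉F) (proj₂ T)

      record Partial (D : List (Subset n)) : Set where
        field
          shelled   : Shelled D
          triangles : ∀ {F} → F List.∈ D → Triangle F
          t₁∈D      : t₁ List.∈ D
          D₀⊆D      : ∀ {F} → F List.∈ D₀ → F List.∈ D

      old? : ∀ u v → Dec (Joined D₀ u v)
      old? = Joined? D₀

      old-≢x : Joined D₀ u v → u ≢ x × v ≢ x
      old-≢x old with J , J∈ , u∈ , v∈ ← List.find old = ∉⇒≢ u∈ (D₀-avoids J∈) , ∉⇒≢ v∈ (D₀-avoids J∈)

      start : Partial (t₁ ∷ D₀)
      start = record
        { shelled   = attaches-new x∈t₁ (List.lose (D₀-complete T₀ x∉t₀) t₁-x⊆t₀)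
                        (λ x-old → let J , J∈ , x∈J = List.find x-old in D₀-avoids J∈ x∈J) ∷ shelled₀
        ; triangles = λ { (here refl) → T₁ ; (there F∈) → D₀-triangle F∈ }
        ; t₁∈D      = here refl
        ; D₀⊆D      = there
        }
        where
        t₁-x⊆t₀ : t₁ - x ⊆ t₀
        t₁-x⊆t₀ z∈ with ∣p∣≤3⇒only (size≤3 (proj₁ T₁)) x∈t₁ a∈t₁ b∈t₁
                          (a≢x ∘ sym) (b≢x ∘ sym) (b≢a ∘ sym) (p-x⊆p t₁ x z∈)
        ... | inj₁ z≡x         = contradiction z≡x (y∈p-x⇒y≢x z∈)
        ... | inj₂ (inj₁ refl) = a∈t₀
        ... | inj₂ (inj₂ refl) = b∈t₀

      module Stuck {D} (P : Partial D)
                   (stuck : ∀ {F} → Triangle F → ¬ F List.∈ D → ¬ Attaches (Covered D) F) where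
        open Partial P

        -- The vertices of the link of `x` in the part shelled so far. Since `t₁` joins `x` to
        -- itself, `x` has to be excluded; otherwise every triangle through `x` would meet `W`.
        W : Pred (Fin n) 0ℓ
        W v = v ≢ x × Joined D x v

        W? : Decidable W
        W? v = ¬? (v Fin.≟ x) ×-dec Joined? D x v

        χ : Fin n → Bool
        χ v = does (W? v)

        φ : Fin n → Fin n → Bool
        φ u v with old? u v
        ... | yes _ = false
        ... | no  _ = χ u xor χ v

        φ-new : ¬ Joined D₀ u v → φ u v ≡ χ u xor χ v
        φ-new {u} {v} new with old? u v
        ... | yes old = contradiction old new
        ... | no  _   = refl

        φ-old : Joined D₀ u v → φ u v ≡ false
        φ-old {u} {v} old with old? u v
        ... | yes _   = refl
        ... | no  new = contradiction old new

        not-two : Triangle F → ¬ F List.∈ D → u ∈ F → v ∈ F → w ∈ F → u ≢ v → u ≢ w → v ≢ w →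
                  Joined D u v → ¬ Joined D v w
        not-two T F∉D u∈ v∈ w∈ u≢v u≢w v≢w uv vw = stuck T F∉D
          (attaches-two (size≤3 (proj₁ T)) (uncovered (proj₁ ∘ triangles) (triangle-facet T) F∉D)
            u∈ v∈ w∈ u≢v u≢w v≢w uv vw)

        -- If `F` is listed, it joins `x` to `v` itself. If not, its edges from `u` to `x` and to
        -- `v` are both covered, so it could still be attached.
        W-spreads : Triangle F → x ∈ F → u ∈ F → v ∈ F → u ≢ v → Joined D₀ u v → W u → W v
        W-spreads {F} T x∈ u∈ v∈ u≢v old (u≢x , xu) with F ∈ₗ? D
        ... | yes F∈D = proj₂ (old-≢x old) , List.lose F∈D (x∈ , v∈)
        ... | no  F∉D = contradiction (let J , J∈ , h = List.find old in List.lose (D₀⊆D J∈) h)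
          (not-two T F∉D x∈ u∈ v∈ (u≢x ∘ sym) (proj₂ (old-≢x old) ∘ sym) u≢v xu)

        χ-old : Triangle F → x ∈ F → u ∈ F → v ∈ F → Joined D₀ u v → χ u ≡ χ v
        χ-old {F} {u} {v} T x∈ u∈ v∈ old with u Fin.≟ v
        ... | yes refl = refl
        ... | no  u≢v  = does-⇔ (mk⇔ (W-spreads T x∈ u∈ v∈ u≢v old)
          (W-spreads T x∈ v∈ u∈ (u≢v ∘ sym) (Joined-sym old))) (W? u) (W? v)

        -- On a triangle avoiding `x` all edges are old and `φ` vanishes. On a triangle through `x`,
        -- `φ` is the coboundary of `χ`, because `χ` agrees at the two ends of an old edge.
        cocycle : Triangle F → Cocycle φ F
        cocycle {F} T with x ∈? F
        ... | no x∉F = coboundary⇒cocycle (λ _ → false) λ u∈ v∈ →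
          φ-old (List.lose (D₀-complete T x∉F) (u∈ , v∈))
        ... | yes x∈F = coboundary⇒cocycle χ cob
          where
          cob : Coboundary φ χ F
          cob {u} {v} u∈ v∈ with old? u v
          ... | no  _   = refl
          ... | yes old = sym (trans (cong (_xor χ v) (χ-old T x∈F u∈ v∈ old)) (xor-same (χ v)))

        -- The closed walk x, a, ..., r, x through t₀ and t′ has odd φ-sum, but at most 7 vertices.

        odd-walk : ∀ {t t′ r u} → Triangle t → Triangle t′ → x ∈ t → x ∉ t′ →
                   r ∈ t → u ∈ t → r ∈ t′ → u ∈ t′ → u ≢ r → W r
        odd-walk {t} {t′} {r} {u} T T′ x∈t x∉t′ r∈t u∈t r∈t′ u∈t′ u≢r =
          -- With `f a ≡ f r`, the potential gives `φ x r ≡ φ x a`. Cancelling `χ x` leaves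
          -- `χ r ≡ χ a`, and `a` is in `W` through `t₁`.
          W-r (xor-injectiveʳ (χ x) (trans (sym (φ-x r)) (trans (cob t∈ x∈t r∈t)
            (trans (cong (f x xor_) (sym fa≡fr)) (trans (sym (cob t₁∈ x∈t₁ a∈t₁)) (φ-x a))))))
          where
          U : Subset n
          U = (t₀ ∪ t′) ∪ ⁅ x ⁆

          T₀∪T′⊆U : t₀ ∪ t′ ⊆ U
          T₀∪T′⊆U = p⊆p∪q ⁅ x ⁆

          U≤7 : ∣ U ∣ ≤ 7
          U≤7 = ℕ.≤-trans (∣p∪q∣≤∣p∣+∣q∣ (t₀ ∪ t′) ⁅ x ⁆) (ℕ.+-mono-≤
            (ℕ.≤-trans (∣p∪q∣≤∣p∣+∣q∣ t₀ t′) (ℕ.+-mono-≤ (size≤3 (proj₁ T₀)) (size≤3 (proj₁ T′))))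
            (ℕ.≤-reflexive (∣⁅x⁆∣≡1 x)))

          U⊂V : U ⊂ V
          U⊂V = small⇒⊂ (⊆-∪ (⊆-∪ (face⊆ K (proj₁ T₀)) (face⊆ K (proj₁ T′)))
            (⁅⁆⊆ (face⊆ K (proj₁ T₁) x∈t₁))) U≤7

          open LocalShelling (local-shelling U⊂V 3) renaming (order to E; shelled to shelledᴱ)

          spanned⊆U : Triangle F → x ∈ F → y ∈ F → z ∈ F → y ≢ x → z ≢ x → z ≢ y →
                      y ∈ t₀ ∪ t′ → z ∈ t₀ ∪ t′ → F ⊆ U
          spanned⊆U T x∈ y∈ z∈ y≢x z≢x z≢y y∈∪ z∈∪ w∈
            with ∣p∣≤3⇒only (size≤3 (proj₁ T)) x∈ y∈ z∈ (y≢x ∘ sym) (z≢x ∘ sym) (z≢y ∘ sym) w∈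
          ... | inj₁ refl        = q⊆p∪q (t₀ ∪ t′) ⁅ x ⁆ (x∈⁅x⁆ x)
          ... | inj₂ (inj₁ refl) = T₀∪T′⊆U y∈∪
          ... | inj₂ (inj₂ refl) = T₀∪T′⊆U z∈∪

          E-complete : Triangle F → F ⊆ U → F List.∈ E
          E-complete T F⊆U = complete (triangle-facet T) F⊆U (proj₂ T)

          t₁∈ : t₁ List.∈ E
          t₁∈ = E-complete T₁ (spanned⊆U T₁ x∈t₁ a∈t₁ b∈t₁ a≢x b≢x b≢a
            (p⊆p∪q t′ a∈t₀) (p⊆p∪q t′ b∈t₀))

          t∈ : t List.∈ E
          t∈ = E-complete T (spanned⊆U T x∈t r∈t u∈t (∉⇒≢ r∈t′ x∉t′) (∉⇒≢ u∈t′ x∉t′) u≢r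
            (q⊆p∪q t₀ t′ r∈t′) (q⊆p∪q t₀ t′ u∈t′))

          pot : ∃[ f ] (∀ {F} → F List.∈ E → Coboundary φ f F)
          pot = potential φ shelledᴱ (λ F∈ → proj₂ (proj₂ (sound F∈)))
            λ F∈ → let KF , _ , 3≤F = sound F∈ in cocycle (KF , 3≤F)

          f : Fin n → Bool
          f = proj₁ pot

          cob : F List.∈ E → Coboundary φ f F
          cob = proj₂ pot

          φ-x : ∀ v → φ x v ≡ χ x xor χ v
          φ-x v = φ-new λ old → proj₁ (old-≢x old) refl

          -- Such a triangle avoids `x`, so its edges are old and the potential has zero difference
          -- along them.
          f-constant : Triangle F → F ⊆ t₀ ∪ t′ → y ∈ F → z ∈ F → f y ≡ f z
          f-constant T F⊆ y∈ z∈ = xor≡false⇒≡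
            (trans (sym (φ-old (List.lose (D₀-complete T x∉F) (y∈ , z∈))))
            (cob (E-complete T (T₀∪T′⊆U ∘ F⊆)) y∈ z∈))
            where
            x∉F : x ∉ _
            x∉F x∈F with x∈p∪q⁻ t₀ t′ (F⊆ x∈F)
            ... | inj₁ x∈t₀ = x∉t₀ x∈t₀
            ... | inj₂ x∈t′ = x∉t′ x∈t′

          fa≡fr : f a ≡ f r
          fa≡fr = constant-on-triangles f T₀ T′ f-constant a∈t₀ r∈t′

          W-r : χ r ≡ χ a → W r
          W-r eq with W? r
          ... | yes Wr = Wr
          ... | no ¬Wr = contradiction (trans (sym (dec-false (W? r) ¬Wr))
            (trans eq (dec-true (W? a) (a≢x , List.lose t₁∈D (x∈t₁ , a∈t₁))))) λ ()

        -- Suppose `r` is outside `W`. If it is new, `t` attaches along the edge from `x` to `s`. If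
        -- it is old, it lies in a listed triangle avoiding `x`, and a crossing around `r` supplies
        -- the two triangles for `odd-walk`.
        mixed : ∀ {t s r} → Triangle t → ¬ t List.∈ D → x ∈ t → s ∈ t → r ∈ t → r ≢ x → W s → W r
        mixed {t} {s} {r} T t∉D x∈t s∈t r∈t r≢x Ws@(s≢x , xs) with W? r
        ... | yes Wr = Wr
        ... | no ¬Wr with any? (r ∈?_) D
        ...   | no r-new = contradiction (attaches-new r∈t (Joined⇒Covered xs only) r-new) (stuck T t∉D)
          where
          only : z ∈ t - r → z ≡ x ⊎ z ≡ s
          only z∈ with ∣p∣≤3⇒only (size≤3 (proj₁ T)) x∈t s∈t r∈t (s≢x ∘ sym) (r≢x ∘ sym)
                         (λ { refl → ¬Wr Ws }) (p-x⊆p t r z∈)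
          ... | inj₁ z≡x        = inj₁ z≡x
          ... | inj₂ (inj₁ z≡s) = inj₂ z≡s
          ... | inj₂ (inj₂ z≡r) = contradiction z≡r (y∈p-x⇒y≢x z∈)
        ...   | yes r-old
          with J , J∈D , r∈J ← List.find r-old
          with _ , soundᶜ , c ← triangle-crossing (x ∈?_) T (triangles J∈D) (⁅⁆⊆ r∈t) (⁅⁆⊆ r∈J) x∈t
                                  (λ x∈J → ¬Wr (r≢x , List.lose J∈D (x∈J , r∈J)))
          with u , u∈ , u≢r ← 2≤∣p∣⇒∃≢ (ℕ.≤-pred (Crossing.m≤ c)) r =
          let open Crossing c
              r∈ = G⊆ (x∈⁅x⁆ r)
          in odd-walk (proj₁ (soundᶜ near∈)) (proj₁ (soundᶜ far∈)) C-near ¬C-far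
               (⊆near r∈) (⊆near u∈) (⊆far r∈) (⊆far u∈) u≢r

        MeetsW : Pred (Subset n) 0ℓ
        MeetsW F = ∃[ s ] s ∈ F × W s

        MeetsW? : Decidable MeetsW
        MeetsW? F = Fin.any? λ s → (s ∈? F) ×-dec W? s

        -- A missing triangle through `x` that meets `W` has both other vertices in `W` by `mixed`,
        -- so two of its edges are covered and it attaches. If it avoids `W`, cross from `t₁` to it
        -- around `x`: the ridge has a vertex `r` besides `x`, and `r` is in `W` because the near
        -- triangle meets `W`.
        nothing-left : Triangle F → F List.∈ D
        nothing-left {F} T with F ∈ₗ? D | x ∈? F
        ... | yes F∈D | _      = F∈D
        ... | no  F∉D | no x∉F = D₀⊆D (D₀-complete T x∉F)
        ... | no  F∉D | yes x∈F with MeetsW? F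
        ...   | yes (s , s∈F , Ws@(s≢x , xs))
          with r , r∈F , r≢x , r≢s ← 3≤∣p∣⇒∃≢≢ (proj₂ T) x s =
          contradiction (proj₂ (mixed T F∉D x∈F s∈F r∈F r≢x Ws))
            (not-two T F∉D s∈F x∈F r∈F s≢x (r≢s ∘ sym) (r≢x ∘ sym) (Joined-sym xs))
        ...   | no ¬meets
          with _ , soundᶜ , c ← triangle-crossing MeetsW? T₁ T (⁅⁆⊆ x∈t₁) (⁅⁆⊆ x∈F)
                                  (a , a∈t₁ , a≢x , List.lose t₁∈D (x∈t₁ , a∈t₁)) ¬meets
          with s , s∈near , Ws ← Crossing.C-near c
             | r , r∈ , r≢x ← 2≤∣p∣⇒∃≢ (ℕ.≤-pred (Crossing.m≤ c)) x =
          contradiction (r , ⊆far r∈ , Wr) ¬C-far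
          where
          open Crossing c
          x∈near : x ∈ near
          x∈near = ⊆near (G⊆ (x∈⁅x⁆ x))
          Wr : W r
          Wr with near ∈ₗ? D
          ... | yes near∈D = r≢x , List.lose near∈D (x∈near , ⊆near r∈)
          ... | no  near∉D = mixed (proj₁ (soundᶜ near∈)) near∉D x∈near s∈near (⊆near r∈) r≢x Ws

    shell-adjacent : TriangleShelling
    shell-adjacent =
      let D , P , all = extend {P = Partial} Triangle? step start
      in D , Partial.shelled P , Partial.triangles P , all
      where
      step : ∀ {D F} → Partial D → Triangle F → ¬ F List.∈ D → ∃[ G ] ¬ G List.∈ D × Partial (G ∷ D)
      step {D} P T F∉D
        with anySubset? (λ G → Triangle? G ×-dec (¬? (G ∈ₗ? D) ×-dec Attaches? (Covered? D) G))
      ... | yes (G , TG , G∉D , att) = G , G∉D , record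
        { shelled   = att ∷ shelled
        ; triangles = λ { (here refl) → TG ; (there F∈) → triangles F∈ }
        ; t₁∈D      = there t₁∈D
        ; D₀⊆D      = there ∘ D₀⊆D
        }
        where open Partial P
      ... | no none = contradiction
        (Stuck.nothing-left P (λ TG G∉D att → none (_ , TG , G∉D , att)) T) F∉D

  -- For the property of being equal to `t`, a crossing is a second triangle sharing an edge with
  -- `t`; `x` is then the vertex of `t` off that edge.
  shell-triangles : ∀ {t} → Triangle t → TriangleShelling
  shell-triangles {t} T with anySubset? (λ F → Triangle? F ×-dec ¬? (F ≟ₛ t))
  ... | no none = t ∷ [] , (λ _ _ ()) ∷ [] , (λ { (here refl) → T }) ,
    λ {F} TF → here (decidable-stable (F ≟ₛ t) λ F≢t → none (F , TF , F≢t))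
  ... | yes (q , Tq , q≢t)
    with _ , sound , c ← triangle-crossing (_≟ₛ t) T Tq ⊥⊆ ⊥⊆ refl q≢t =
    go c (proj₁ (sound (Crossing.near∈ c))) (proj₁ (sound (Crossing.far∈ c)))
    where
    go : (c : Crossing D (_≡ t) ⊥ 3) → Triangle (Crossing.near c) → Triangle (Crossing.far c) →
         TriangleShelling
    go c Tn Tf
      with a , a∈ ← 0<∣p∣⇒Nonempty (ℕ.≤-trans (s≤s z≤n) (ℕ.≤-pred (Crossing.m≤ c)))
      with b , b∈ , b≢a ← 2≤∣p∣⇒∃≢ (ℕ.≤-pred (Crossing.m≤ c)) a
      with x , x∈ , x∉ ← ⊈⇒∃ {p = Crossing.near c} {q = Crossing.far c}
                         (λ near⊆far → Crossing.¬C-far c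
           (trans (sym (proj₂ (triangle-facet Tn) _ (proj₁ Tf) near⊆far)) (Crossing.C-near c))) =
      shell-adjacent Tn Tf x∈ x∉ (⊆near a∈) (⊆near b∈) (⊆far a∈) (⊆far b∈) b≢a
      where open Crossing c

  -- Adding edge facets and isolated vertices.

  private
    record PartialShelling (D : List (Subset n)) : Set where
      field
        shelled   : Shelled D
        facets    : ∀ {F} → F List.∈ D → IsFacet (Face K) F
        triangles : ∀ {F} → Triangle F → F List.∈ D

  has-triangle⇒shellable : ∀ {t} → Triangle t → Shellable K
  has-triangle⇒shellable {t} T =
    let _ , shelled₁ , sound₁ , complete₁ = shell-triangles T
        _ , P , all = extend {P = PartialShelling} {Q = IsFacet (Face K)} facet? step record
          { shelled = shelled₁ ; facets = triangle-facet ∘ sound₁ ; triangles = complete₁ }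
    in shellable⁺ K (PartialShelling.shelled P) (PartialShelling.facets P , all)
    where
    facet? : Decidable (IsFacet (Face K))
    facet? F with face? K F
    ... | no ¬KF = no (¬KF ∘ proj₁)
    ... | yes KF with anySubset? (λ G → face? K G ×-dec ((F ⊆? G) ×-dec ¬? (F ≟ₛ G)))
    ...   | yes (G , KG , F⊆G , F≢G) = no λ (_ , maximal) → F≢G (maximal G KG F⊆G)
    ...   | no none = yes (KF , λ G KG F⊆G → decidable-stable (F ≟ₛ G)
      λ F≢G → none (G , KG , (λ {x} → F⊆G {x}) , F≢G))

    step : ∀ {D F} → PartialShelling D → IsFacet (Face K) F → ¬ F List.∈ D →
           ∃[ G ] ¬ G List.∈ D × PartialShelling (G ∷ D)
    step {D} {F} P facet-F F∉D = conclude candidate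
      where
      open PartialShelling P

      conclude : ∃[ G ] IsFacet (Face K) G × ¬ G List.∈ D × Attaches (Covered D) G →
                 ∃[ G ] ¬ G List.∈ D × PartialShelling (G ∷ D)
      conclude (G , facet-G , G∉D , att) = G , G∉D , record
        { shelled   = att ∷ shelled
        ; facets    = λ { (here refl) → facet-G ; (there F∈) → facets F∈ }
        ; triangles = there ∘ triangles
        }

      size≤2 : ∀ {G} → Face K G → ¬ G List.∈ D → ∣ G ∣ ≤ 2
      size≤2 KG G∉D = ℕ.≤-pred (ℕ.≰⇒> λ 3≤G → G∉D (triangles (KG , 3≤G)))

      attach-old : ∀ {G y} → IsFacet (Face K) G → ¬ G List.∈ D → y ∈ G → Any (y ∈_) D →
                   ∃[ G ] IsFacet (Face K) G × ¬ G List.∈ D × Attaches (Covered D) G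
      attach-old {G} facet-G G∉D y∈ y-old = G , facet-G , G∉D ,
        attaches-old (size≤2 (proj₁ facet-G) G∉D) (uncovered (proj₁ ∘ facets) facet-G G∉D) y∈ y-old

      Meets : Pred (Subset n) 0ℓ
      Meets G = ∃[ u ] u ∈ G × u ∈ F

      Meets? : Decidable Meets
      Meets? G = Fin.any? λ u → (u ∈? G) ×-dec (u ∈? F)

      -- A facet with an old vertex, or with a single vertex, attaches directly. For an edge with
      -- two new ends, a path of faces from it to `t` leads to another missing facet that does have
      -- an old vertex.
      candidate : ∃[ G ] IsFacet (Face K) G × ¬ G List.∈ D × Attaches (Covered D) G
      candidate with Fin.any? (λ y → (y ∈? F) ×-dec any? (y ∈?_) D) | nonempty? F
      ... | yes (y , y∈F , y-old) | _ = attach-old facet-F F∉D y∈F y-old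
      -- The empty face lies in `t`, so as a facet it would equal `t`, which is listed.
      ... | no _ | no empty = contradiction (subst (List._∈ D)
        (sym (proj₂ facet-F t (proj₁ T) λ v∈F → contradiction (_ , v∈F) empty)) (triangles T)) F∉D
      ... | no all-new | yes (v , v∈F) with 2 ℕ.≤? ∣ F ∣
      ...   | no 2≰F = F , facet-F , F∉D , attaches-new v∈F (List.lose (triangles T) F-v⊆t)
        (λ v-old → all-new (v , v∈F , v-old))
        where
        F-v⊆t : F - v ⊆ t
        F-v⊆t z∈ = contradiction (subst (2 ≤_) (sym (x∈p⇒∣p∣≡1+∣p-x∣ v∈F))
          (s≤s (ℕ.≤-trans (s≤s z≤n) (x∈p⇒∣p-x∣<∣p∣ z∈)))) 2≰F
      ...   | yes 2≤F
        with _ , sound , c ← facet-crossing 2 Meets? facet-F (triangle-facet T) 2≤F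
               (ℕ.≤-trans (s≤s (s≤s z≤n)) (proj₂ T)) ⊥⊆ ⊥⊆ (v , v∈F , v∈F)
               (λ (u , u∈t , u∈F) → all-new (u , u∈F , List.lose (triangles T) u∈t))
        with u , u∈near , u∈F ← Crossing.C-near c
           | y , y∈ ← 0<∣p∣⇒Nonempty (ℕ.≤-pred (Crossing.m≤ c))
        -- `near` is only known to be a face of `K`. Any facet `J` above it contains the new vertex
        -- `u`, hence is missing, and also the vertex `y` of `t`, which is old.
        with J , facet-J , near⊆J ← facet-above (face? K) (proj₁ (sound (Crossing.near∈ c))) =
        attach-old facet-J (λ J∈D → all-new (u , u∈F , List.lose J∈D (near⊆J u∈near)))
          (near⊆J (⊆near y∈)) (List.lose (triangles T) y∈t)
        where
        open Crossing c
        y∈t : y ∈ t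
        y∈t with x∈p∪q⁻ F t (proj₁ (proj₂ (sound far∈)) (⊆far y∈))
        ... | inj₁ y∈F = contradiction (y , ⊆far y∈ , y∈F) ¬C-far
        ... | inj₂ y∈t = y∈t

theorem3 : ∀ {n : ℕ} (K : SimplicialComplex n) →
    HasDimension (Face K) (+ 2) → IsObstruction K → ∣ vertices K ∣ ≤ 7
theorem3 K ((t , Kt , dim-t) , dim≤2) (¬shellable , shellable) = ℕ.≮⇒≥ λ 7<∣V∣ →
  ¬shellable (has-triangle⇒shellable K (λ {F} KF → ∣F∣≤3 F (dim≤2 F KF)) 7<∣V∣ shellable
    (Kt , 3≤∣t∣))
  where
  ∣F∣≤3 : ∀ F → dim F ℤ.≤ + 2 → ∣ F ∣ ≤ 3
  ∣F∣≤3 F dim≤ = ℕ.≮⇒≥ λ 3<F → ℤ.<⇒≱ (ℤ.+-monoˡ-< (ℤ.- 1ℤ) (ℤ.+<+ 3<F)) dim≤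

  3≤∣t∣ : 3 ≤ ∣ t ∣
  3≤∣t∣ = ℕ.≮⇒≥ λ t<3 →
    ℤ.<⇒≱ (ℤ.+-monoˡ-< (ℤ.- 1ℤ) (ℤ.+<+ t<3)) (ℤ.≤-reflexive (sym dim-t))
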